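{- Let $G$ be a ${\rm b}^{\ast}$-monotonic graph of girth greater than four such that no two distinct 5-cycles of $G$ intersect in a path of length two. Then ${\rm b}^{\ast}(G)=m^{\ast}(G)+1$.
   Context: Graphs are finite, simple, undirected; $d(v)$ is the degree and $N(v)$ the neighbourhood of $v$; the girth is the length of a shortest cycle (infinite for forests). For a proper coloring $c:V(G)\to\{1,\dots,k\}$, a vertex $u$ is a b-vertex if every color $j\in\{1,\dots,k\}\setminus\{c(u)\}$ appears on a neighbour of $u$. A ${\rm b}^{\ast}$-coloring with $k$ colors is a proper coloring $c:V(G)\to\{1,\dots,k\}$ containing a b-vertex $u$ with $c(u)=k$ such that for each $j<k$, $u$ is adjacent to a b-vertex of color $j$; ${\rm b}^{\ast}(G)$ is the maximum $k$ for which $G$ has such a coloring. $G$ is ${\rm b}^{\ast}$-monotonic if ${\rm b}^{\ast}(H_2)\le{\rm b}^{\ast}(H_1)$ for every induced subgraph $H_1$ of $G$ and every induced subgraph $H_2$ of $H_1$. $m^{\ast}(G)$ is the maximum $k\ge0$ such that there exist $u\in V(G)$ and distinct $u_1,\dots,u_k\in N(u)$ with $d(u_i)\ge k$ for all $i$. -}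

module Defs where

open import Data.Nat using (ℕ; zero; suc; _≤_; _<_)
open import Data.Fin using (Fin; zero; suc)
open import Data.Fin.Subset using (Subset; _∈_; _⊆_; ⊤)
open import Data.List using (List; length; filter)
open import Data.List using () renaming (allFin to allFinL)
open import Data.Product using (Σ; ∃; _×_; _,_)
open import Data.Sum using (_⊎_)
open import Relation.Nullary using (¬_; Dec)
open import Relation.Binary.PropositionalEquality using (_≡_; _≢_)
open import Function.Definitions using (Injective)
open import Function.Bundles using (_⇔_)

record Graph : Set₁ where
  field
    n      : ℕ
    Adj    : Fin n → Fin n → Set
    adj?   : ∀ u v → Dec (Adj u v)
    sym    : ∀ {u v} → Adj u v → Adj v u
    irrefl : ∀ {u} → ¬ Adj u u

module _ (G : Graph) where
  open Graph G

  deg : Fin n → ℕ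
  deg v = length (filter (adj? v) (allFinL n))

  ProperColoringOn : Subset n → ℕ → (Fin n → ℕ) → Set
  ProperColoringOn S k c =
    (∀ v → v ∈ S → 1 ≤ c v × c v ≤ k) ×
    (∀ u v → u ∈ S → v ∈ S → Adj u v → c u ≢ c v)

  IsBVertexOn : Subset n → ℕ → (Fin n → ℕ) → Fin n → Set
  IsBVertexOn S k c u =
    ∀ j → 1 ≤ j → j ≤ k → j ≢ c u →
      Σ (Fin n) λ w → w ∈ S × Adj u w × c w ≡ j

  HasBStarColoringOn : Subset n → ℕ → Set
  HasBStarColoringOn S k =
    Σ (Fin n → ℕ) λ c → ProperColoringOn S k c ×
    Σ (Fin n) λ u → u ∈ S × c u ≡ k × IsBVertexOn S k c u ×
      (∀ j → 1 ≤ j → j < k →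
        Σ (Fin n) λ w → w ∈ S × Adj u w × c w ≡ j × IsBVertexOn S k c w)

  IsBStarOn : Subset n → ℕ → Set
  IsBStarOn S k = HasBStarColoringOn S k × (∀ j → HasBStarColoringOn S j → j ≤ k)

  IsBStar : ℕ → Set
  IsBStar k = IsBStarOn ⊤ k

  -- b*-monotonic: b*(H₂) ≤ b*(H₁) for induced H₂ ⊆ H₁ ⊆ G
  -- (an induced subgraph of G[S₁] is G[S₂] for some S₂ ⊆ S₁)
  BStarMonotonic : Set
  BStarMonotonic =
    ∀ (S₁ S₂ : Subset n) → S₂ ⊆ S₁ → ∀ k₁ k₂ →
      IsBStarOn S₁ k₁ → IsBStarOn S₂ k₂ → k₂ ≤ k₁

  HasMStarWitness : ℕ → Set
  HasMStarWitness k =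
    Σ (Fin n) λ u → Σ (Fin k → Fin n) λ us → Injective _≡_ _≡_ us ×
      (∀ i → Adj u (us i) × k ≤ deg (us i))

  IsMStar : ℕ → Set
  IsMStar k = HasMStarWitness k × (∀ j → HasMStarWitness j → j ≤ k)

  NoTriangle : Set
  NoTriangle = ∀ a b c → Adj a b → Adj b c → ¬ Adj c a

  NoFourCycle : Set
  NoFourCycle = ∀ a b c d → a ≢ c → b ≢ d →
    Adj a b → Adj b c → Adj c d → ¬ Adj d a

  GirthGreaterThanFour : Set
  GirthGreaterThanFour = NoTriangle × NoFourCycle

  next5 : Fin 5 → Fin 5
  next5 zero = suc zero
  next5 (suc zero) = suc (suc zero)
  next5 (suc (suc zero)) = suc (suc (suc zero))
  next5 (suc (suc (suc zero))) = suc (suc (suc (suc zero)))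
  next5 (suc (suc (suc (suc zero)))) = zero

  record Cycle5 : Set where
    field
      vtx   : Fin 5 → Fin n
      inj   : Injective _≡_ _≡_ vtx
      edges : ∀ i → Adj (vtx i) (vtx (next5 i))

  open Cycle5

  OnCycle : Cycle5 → Fin n → Set
  OnCycle C x = ∃ λ i → vtx C i ≡ x

  EdgeOf : Cycle5 → Fin n → Fin n → Set
  EdgeOf C x y = ∃ λ i →
    (vtx C i ≡ x × vtx C (next5 i) ≡ y) ⊎ (vtx C i ≡ y × vtx C (next5 i) ≡ x)

  -- two 5-cycles are the same subgraph iff they have the same edge set
  SameCycle : Cycle5 → Cycle5 → Set
  SameCycle C D = ∀ x y → EdgeOf C x y ⇔ EdgeOf D x y

  IntersectInP2 : Cycle5 → Cycle5 → Set
  IntersectInP2 C D = Σ (Fin n) λ x → Σ (Fin n) λ y → Σ (Fin n) λ z →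
    x ≢ y × y ≢ z × x ≢ z ×
    (∀ w → (OnCycle C w × OnCycle D w) ⇔ (w ≡ x ⊎ w ≡ y ⊎ w ≡ z)) ×
    (∀ a b → (EdgeOf C a b × EdgeOf D a b) ⇔
        ((a ≡ x × b ≡ y) ⊎ (a ≡ y × b ≡ x) ⊎ (a ≡ y × b ≡ z) ⊎ (a ≡ z × b ≡ y)))

  NoTwoFiveCyclesMeetInP2 : Set
  NoTwoFiveCyclesMeetInP2 = ∀ C D → ¬ SameCycle C D → ¬ IntersectInP2 C D

{-# OPTIONS --safe #-}
module Submission where

-- Upper bound: in a b*-coloring with k + 1 colors the central vertex sees k
-- b-vertices, each of degree at least k.
--
-- Lower bound: let u have neighbours u₁, …, uₘ of degree at least m.  For i ≠ j
-- there is at most one edge between N(uᵢ) ∖ u and N(uⱼ) ∖ u, since two of them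
-- give 5-cycles sharing the path uᵢ u uⱼ; and a vertex v of N(uᵢ) ∖ u has
-- neighbours in at most one N(uⱼ) ∖ u, since otherwise two 5-cycles share
-- u uᵢ v.  So we may choose an injection g i from the colors into N(uᵢ) with
-- g i i = u for which g i j is the endpoint of the edge between N(uᵢ) and N(uⱼ)
-- whenever that edge exists.  Coloring u by m + 1, uᵢ by i and g i j by j is
-- then a b*-coloring of an induced subgraph, and monotonicity transfers it.
--
-- Monotonicity only speaks about graphs whose b* exists.  Starting from the
-- coloring by distinct colors, either some vertex of the last color witnesses a
-- b*-coloring, or every vertex of that color can be recolored and the last color
-- is dropped; so some b*-coloring exists, and a bounded search finds the maximum.

open import Defs
open import Data.Nat using (ℕ; zero; suc; _≤_; _<_; z≤n; s≤s; s≤s⁻¹)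
import Data.Nat.Properties as ℕ
open import Data.Fin using (Fin; zero; suc; toℕ; fromℕ<; inject≤; punchIn; punchOut;
                            finToFun; funToFin)
open import Data.Fin.Patterns using (0F; 1F; 2F; 3F; 4F)
open import Data.Fin.Properties
  using (_≟_; any?; all?; toℕ-injective; toℕ<n; toℕ-fromℕ<; injective⇒≤;
         punchIn-injective; punchInᵢ≢i; punchOut-injective; finToFun-funToFin;
         inject≤-injective)
open import Data.Fin.Subset using (Subset; _∈_; ⊤)
open import Data.Fin.Subset.Properties using (_∈?_; ∈⊤)
open import Data.Vec using (tabulate)
open import Data.Vec.Properties using (lookup∘tabulate; lookup⇒[]=; []=⇒lookup)
open import Data.List using (List; []; _∷_; lookup; filter; allFin)
open import Data.List.Relation.Unary.All as All using (All; []; _∷_)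
open import Data.List.Relation.Unary.Any using (here; there; index)
open import Data.List.Relation.Unary.Any.Properties using (lookup-index)
open import Data.List.Relation.Unary.AllPairs using ([]; _∷_)
open import Data.List.Relation.Unary.Unique.Propositional using (Unique)
open import Data.List.Relation.Unary.Unique.Propositional.Properties using (allFin⁺; filter⁺)
import Data.List.Membership.Propositional as List
open import Data.List.Membership.Propositional.Properties
  using (∈-filter⁺; ∈-filter⁻; ∈-allFin; ∈-lookup)
open import Data.Product using (Σ; ∃; _×_; _,_; proj₁; proj₂)
open import Data.Sum using (_⊎_; inj₁; inj₂)
open import Data.Empty using (⊥-elim)
open import Function using (_∘_; id)
open import Function.Definitions using (Injective)
open import Function.Bundles using (mk⇔; module Equivalence)
open import Relation.Nullary using (¬_; Dec; yes; no; contradiction)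
open import Relation.Nullary.Decidable
  using (map′; ¬?; _×-dec_; _⊎-dec_; _→-dec_; does; dec-true; decidable-stable)
open import Relation.Binary.PropositionalEquality
  using (_≡_; _≢_; _≗_; refl; sym; trans; cong; subst; ≢-sym)

-- Bounded search over numbers, colors and maps between finite sets.

bounded-maximum : {P : ℕ → Set} → (∀ k → Dec (P k)) → ∃ P → ∀ b → (∀ j → P j → j ≤ b) →
  Σ ℕ λ k → P k × (∀ j → P j → j ≤ k)
bounded-maximum P? ∃P b P≤b with P? b
... | yes Pb = b , Pb , P≤b
bounded-maximum {P} P? (j , Pj) zero P≤b | no ¬P0 =
  contradiction (subst P (ℕ.n≤0⇒n≡0 (P≤b j Pj)) Pj) ¬P0
bounded-maximum {P} P? ∃P (suc b) P≤b | no ¬Pb = bounded-maximum P? ∃P b P≤b′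
  where
  P≤b′ : ∀ j → P j → j ≤ b
  P≤b′ j Pj = s≤s⁻¹ (ℕ.≤∧≢⇒< (P≤b j Pj) λ { refl → ¬Pb Pj })

-- A sum instead of a decision, because the failing branch must hand over an explicit number:
-- recoloring uses it as the color to move to or to free.
all-or-missing : {P : ℕ → Set} → (∀ j → Dec (P j)) → ∀ k →
  (∀ j → 1 ≤ j → j ≤ k → P j) ⊎ Σ ℕ λ j → 1 ≤ j × j ≤ k × ¬ P j
all-or-missing P? zero = inj₁ λ { zero () _ ; (suc _) _ () }
all-or-missing {P} P? (suc k) with P? (suc k) | all-or-missing P? k
... | no ¬P | _ = inj₂ (suc k , s≤s z≤n , ℕ.≤-refl , ¬P)
... | yes _ | inj₂ (j , 1≤j , j≤k , ¬P) = inj₂ (j , 1≤j , ℕ.m≤n⇒m≤1+n j≤k , ¬P)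
... | yes p | inj₁ all = inj₁ all′
  where
  all′ : ∀ j → 1 ≤ j → j ≤ suc k → P j
  all′ j 1≤j j≤1+k with ℕ.m≤n⇒m<n∨m≡n j≤1+k
  ... | inj₁ j<1+k = all j 1≤j (s≤s⁻¹ j<1+k)
  ... | inj₂ refl = p

all-upTo? : {P : ℕ → Set} → (∀ j → Dec (P j)) → ∀ k → Dec (∀ j → 1 ≤ j → j ≤ k → P j)
all-upTo? P? k with all-or-missing P? k
... | inj₁ all = yes all
... | inj₂ (j , 1≤j , j≤k , ¬P) = no λ all → ¬P (all j 1≤j j≤k)

color-index : ∀ {k} x → 1 ≤ x → x ≤ k → Σ (Fin k) λ i → suc (toℕ i) ≡ x
color-index (suc x) _ x<k = fromℕ< x<k , cong suc (toℕ-fromℕ< x<k)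

-- `finToFun` enumerates the finitely many maps. Encoding and decoding returns a map only up to
-- pointwise equality, hence the requirement that `P` respect `≗`.
any-function? : ∀ {m k} {P : (Fin m → Fin k) → Set} → (∀ f → Dec (P f)) →
  (∀ {f g} → f ≗ g → P f → P g) → Dec (∃ P)
any-function? P? resp = map′
  (λ (i , p) → finToFun i , p)
  (λ (f , p) → funToFin f , resp (λ x → sym (finToFun-funToFin f x)) p)
  (any? (P? ∘ finToFun))

-- Pigeonhole: if `j` were avoided, `punchOut` would turn `h` into an injection into a set with one
-- element fewer.
injective⇒hits : ∀ {m} (h : Fin m → Fin m) → Injective _≡_ _≡_ h → ∀ j → ¬ (∀ i → j ≢ h i)
injective⇒hits {suc m} h h-inj j j≢h = ℕ.1+n≰n
  (injective⇒≤ {f = λ i → punchOut (j≢h i)} λ {a} {b} eq →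
    h-inj (punchOut-injective (j≢h a) (j≢h b) eq))

Unique⇒lookup-injective : ∀ {A : Set} {xs : List A} → Unique xs → Injective _≡_ _≡_ (lookup xs)
Unique⇒lookup-injective (x∉xs ∷ _) {zero} {zero} _ = refl
Unique⇒lookup-injective (x∉xs ∷ _) {zero} {suc j} eq =
  contradiction eq (All.lookup x∉xs (∈-lookup j))
Unique⇒lookup-injective (x∉xs ∷ _) {suc i} {zero} eq =
  contradiction (sym eq) (All.lookup x∉xs (∈-lookup i))
Unique⇒lookup-injective (_ ∷ uniq) {suc i} {suc j} eq =
  cong suc (Unique⇒lookup-injective uniq eq)

module _ {n : ℕ} {P : Fin n → Set} (P? : ∀ v → Dec (P v)) where

  subset : Subset n
  subset = tabulate (does ∘ P?)

  ∈-subset⁺ : ∀ {v} → P v → v ∈ subset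
  ∈-subset⁺ {v} p = lookup⇒[]= v subset (trans (lookup∘tabulate _ v) (dec-true (P? v) p))

  ∈-subset⁻ : ∀ {v} → v ∈ subset → P v
  ∈-subset⁻ {v} v∈ with P? v | trans (sym (lookup∘tabulate (does ∘ P?) v)) ([]=⇒lookup v∈)
  ... | yes p | _ = p

-- Extending a partial injection to a total one.

-- A decidable relation, so that forced values can be given by a logical description and new pairs
-- added by a disjunction.
record PartialInjection (m {n} : ℕ) (N : Fin n → Set) : Set₁ where
  field
    Rel        : Fin m → Fin n → Set
    rel?       : ∀ i x → Dec (Rel i x)
    functional : ∀ {i x y} → Rel i x → Rel i y → x ≡ y
    injective  : ∀ {i j x} → Rel i x → Rel j x → i ≡ j
    sound      : ∀ {i x} → Rel i x → N x

open PartialInjection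

module _ {m n : ℕ} {N : Fin n → Set} (e : Fin m → Fin n) (e-inj : Injective _≡_ _≡_ e)
         (e∈N : ∀ a → N (e a)) where

  -- If all `m` values of `e` were in use, sending `a` to the index that uses `e a` would be an
  -- injection of `Fin m` into itself. It would hit `j`, so `j` would be defined. The values of `R`
  -- itself may lie outside the image of `e`.
  fresh : (R : PartialInjection m N) (j : Fin m) → ¬ ∃ (Rel R j) →
    ∃ λ a → ¬ ∃ λ i → Rel R i (e a)
  fresh R j undefined with any? (λ a → ¬? (any? λ i → rel? R i (e a)))
  ... | yes found = found
  ... | no none = ⊥-elim (injective⇒hits (proj₁ ∘ hit)
          (λ {a} {b} eq → e-inj (functional R (proj₂ (hit a))
            (subst (λ i → Rel R i (e b)) (sym eq) (proj₂ (hit b)))))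
          j (λ a j≡ → undefined (e a , subst _ (sym j≡) (proj₂ (hit a)))))
    where
    hit : ∀ a → ∃ λ i → Rel R i (e a)
    hit a = decidable-stable (any? λ i → rel? R i (e a)) λ ¬hit → none (a , ¬hit)

  define-at : (R : PartialInjection m N) (j : Fin m) → Σ (PartialInjection m N) λ R′ →
    (∀ {i x} → Rel R i x → Rel R′ i x) × ∃ (Rel R′ j)
  define-at R j with any? (rel? R j)
  ... | yes defined = R , id , defined
  ... | no undefined with fresh R j undefined
  ...   | a , unused = R′ , inj₁ , e a , inj₂ (refl , refl)
    where
    R′ : PartialInjection m N
    R′ .Rel i x = Rel R i x ⊎ (i ≡ j × x ≡ e a)
    R′ .rel? i x = rel? R i x ⊎-dec ((i ≟ j) ×-dec (x ≟ e a))
    R′ .functional (inj₁ r) (inj₁ s) = functional R r s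
    R′ .functional (inj₁ r) (inj₂ (refl , _)) = contradiction (_ , r) undefined
    R′ .functional (inj₂ (refl , _)) (inj₁ s) = contradiction (_ , s) undefined
    R′ .functional (inj₂ (_ , refl)) (inj₂ (_ , refl)) = refl
    R′ .injective (inj₁ r) (inj₁ s) = injective R r s
    R′ .injective (inj₁ r) (inj₂ (_ , refl)) = contradiction (_ , r) unused
    R′ .injective (inj₂ (_ , refl)) (inj₁ s) = contradiction (_ , s) unused
    R′ .injective (inj₂ (refl , _)) (inj₂ (refl , _)) = refl
    R′ .sound (inj₁ r) = sound R r
    R′ .sound (inj₂ (_ , refl)) = e∈N a

  define-on : (R : PartialInjection m N) (js : List (Fin m)) → Σ (PartialInjection m N) λ R′ →
    (∀ {i x} → Rel R i x → Rel R′ i x) × (∀ {j} → j List.∈ js → ∃ (Rel R′ j))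
  define-on R [] = R , id , λ ()
  define-on R (j ∷ js) with define-on R js
  ... | R₁ , R⊆R₁ , defined with define-at R₁ j
  ...   | R₂ , R₁⊆R₂ , definedⱼ = R₂ , R₁⊆R₂ ∘ R⊆R₁ , λ where
    (here refl) → definedⱼ
    (there j∈js) → let (x , r) = defined j∈js in x , R₁⊆R₂ r

  -- Undefined indices are filled one at a time from the `m` candidates of `e`; existing pairs never
  -- change, so the values forced by `R` survive.
  extend-injection : (R : PartialInjection m N) → Σ (Fin m → Fin n) λ g →
    Injective _≡_ _≡_ g × (∀ j → N (g j)) × (∀ {j x} → Rel R j x → g j ≡ x)
  extend-injection R with define-on R (allFin m)
  ... | R′ , R⊆R′ , defined =
    (λ j → proj₁ (val j)) ,
    (λ {i} {j} eq → injective R′ (proj₂ (val i)) (subst (Rel R′ j) (sym eq) (proj₂ (val j)))) ,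
    (λ j → sound R′ (proj₂ (val j))) ,
    (λ {j} r → functional R′ (proj₂ (val j)) (R⊆R′ r))
    where
    val : ∀ j → ∃ (Rel R′ j)
    val j = defined (∈-allFin j)

-- Degrees, b-vertices and the upper bound.

module _ (G : Graph) where
  open Graph G renaming (sym to symm)

  neighbours : Fin n → List (Fin n)
  neighbours v = filter (adj? v) (allFin n)

  injection⇒≤deg : ∀ {k v} (e : Fin k → Fin n) → Injective _≡_ _≡_ e →
    (∀ a → Adj v (e a)) → k ≤ deg G v
  injection⇒≤deg {k} {v} e e-inj adj = injective⇒≤ {f = λ a → index (e∈ a)} λ {a} {b} eq →
    e-inj (trans (lookup-index (e∈ a))
      (trans (cong (lookup (neighbours v)) eq) (sym (lookup-index (e∈ b)))))
    where
    e∈ : ∀ a → e a List.∈ neighbours v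
    e∈ a = ∈-filter⁺ (adj? v) (∈-allFin (e a)) (adj a)

  ≤deg⇒injection : ∀ {k v} → k ≤ deg G v → Σ (Fin k → Fin n) λ e →
    Injective _≡_ _≡_ e × (∀ a → Adj v (e a))
  ≤deg⇒injection {k} {v} k≤d =
    (λ a → lookup (neighbours v) (inject≤ a k≤d)) ,
    (λ {a} {b} eq → inject≤-injective k≤d k≤d a b
      (Unique⇒lookup-injective (filter⁺ (adj? v) (allFin⁺ n)) eq)) ,
    (λ a → proj₂ (∈-filter⁻ (adj? v) {xs = allFin n} (∈-lookup (inject≤ a k≤d))))

  module _ (S : Subset n) where

    isBVertex? : ∀ k c u → Dec (IsBVertexOn G S k c u)
    isBVertex? k c u = all-upTo? (λ j → ¬? (j ℕ.≟ c u) →-dec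
      any? (λ w → (w ∈? S) ×-dec adj? u w ×-dec (c w ℕ.≟ j))) k

    bVertex⇒degree : ∀ {k c u} → ProperColoringOn G S (suc k) c → u ∈ S →
      IsBVertexOn G S (suc k) c u → k ≤ deg G u
    bVertex⇒degree {k} {c} {u} (range , _) u∈S b =
      injection⇒≤deg (λ a → proj₁ (nbr a))
        (λ {a} {a′} eq → punchIn-injective own a a′ (toℕ-injective (ℕ.suc-injective
          (trans (sym (col a)) (trans (cong c eq) (col a′))))))
        (λ a → proj₁ (proj₂ (proj₂ (nbr a))))
      where
      own : Fin (suc k)
      own = proj₁ (color-index (c u) (proj₁ (range u u∈S)) (proj₂ (range u u∈S)))
      own≡ : suc (toℕ own) ≡ c u
      own≡ = proj₂ (color-index (c u) (proj₁ (range u u∈S)) (proj₂ (range u u∈S)))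
      -- `punchIn own` runs through the `k` colors other than that of `u`, so these neighbours are
      -- distinct.
      nbr : ∀ a → Σ (Fin n) λ w → w ∈ S × Adj u w × c w ≡ suc (toℕ (punchIn own a))
      nbr a = b _ (s≤s z≤n) (toℕ<n (punchIn own a)) λ eq →
        punchInᵢ≢i own a (toℕ-injective (ℕ.suc-injective (trans eq (sym own≡))))
      col : ∀ a → c (proj₁ (nbr a)) ≡ suc (toℕ (punchIn own a))
      col a = proj₂ (proj₂ (proj₂ (nbr a)))

    bStarColoring⇒mStarWitness : ∀ {k} → HasBStarColoringOn G S (suc k) → HasMStarWitness G k
    bStarColoring⇒mStarWitness {k} (c , proper , u , u∈S , cu≡k , bu , nbrs) =
      u , proj₁ ∘ nbr ,
      (λ {a} {b} eq → toℕ-injective (ℕ.suc-injective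
        (trans (sym (col a)) (trans (cong c eq) (col b))))) ,
      (λ a → let (w , w∈S , u~w , _ , bw) = nbr a in u~w , bVertex⇒degree proper w∈S bw)
      where
      nbr : (a : Fin k) → Σ (Fin n) λ w →
        w ∈ S × Adj u w × c w ≡ suc (toℕ a) × IsBVertexOn G S (suc k) c w
      nbr a = nbrs (suc (toℕ a)) (s≤s z≤n) (s≤s (toℕ<n a))
      col : ∀ a → c (proj₁ (nbr a)) ≡ suc (toℕ a)
      col a = proj₁ (proj₂ (proj₂ (proj₂ (nbr a))))

    IsCenter : ℕ → (Fin n → ℕ) → Fin n → Set
    IsCenter k c u = u ∈ S × c u ≡ k × IsBVertexOn G S k c u ×
      (∀ j → 1 ≤ j → j < k →
        Σ (Fin n) λ w → w ∈ S × Adj u w × c w ≡ j × IsBVertexOn G S k c w)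

    -- Neighbours inside `S` are neighbours in `G`, so degrees in `G` bound the colorings of every
    -- induced subgraph. The conclusion of the proof needs this both for `⊤` and for the subgraph
    -- built around a vertex.
    bStarColoring-≤ : ∀ {m} → (∀ j → HasMStarWitness G j → j ≤ m) →
      ∀ k → HasBStarColoringOn G S k → k ≤ suc m
    bStarColoring-≤ ub zero _ = z≤n
    bStarColoring-≤ ub (suc k) h = s≤s (ub k (bStarColoring⇒mStarWitness h))

  -- Existence of m*.

  mStarWitness-≤ : ∀ j → HasMStarWitness G j → j ≤ n
  mStarWitness-≤ j (_ , _ , us-inj , _) = injective⇒≤ us-inj

  mStarWitness? : ∀ k → Dec (HasMStarWitness G k)
  mStarWitness? k = any? λ u → any-function?
    (λ us → map′ (λ inj {i} {j} → inj i j) (λ inj i j → inj)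
              (all? λ i → all? λ j → (us i ≟ us j) →-dec (i ≟ j))
            ×-dec all? (λ i → adj? u (us i) ×-dec (k ℕ.≤? deg G (us i))))
    (λ f≗g (inj , good) →
      (λ {i} {j} eq → inj (trans (f≗g i) (trans eq (sym (f≗g j))))) ,
      (λ i → subst (λ w → Adj u w × k ≤ deg G w) (f≗g i) (good i)))

  mStar-exists : Fin n → Σ ℕ (IsMStar G)
  mStar-exists x = bounded-maximum mStarWitness?
    -- The empty family at `x` witnesses the value 0, which starts the search.
    (0 , x , (λ ()) , (λ {}) , λ ()) n mStarWitness-≤

  -- Deciding b*-colorings of the whole graph.

  Proper : ℕ → (Fin n → ℕ) → Set
  Proper = ProperColoringOn G ⊤

  IsB : ℕ → (Fin n → ℕ) → Fin n → Set
  IsB = IsBVertexOn G ⊤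

  isCenter? : ∀ k c u → Dec (IsCenter ⊤ k c u)
  isCenter? zero c u = (u ∈? ⊤) ×-dec (c u ℕ.≟ zero) ×-dec isBVertex? ⊤ zero c u ×-dec
    yes λ _ _ ()
  isCenter? (suc k) c u = (u ∈? ⊤) ×-dec (c u ℕ.≟ suc k) ×-dec isBVertex? ⊤ (suc k) c u ×-dec
    map′ (λ f j 1≤j j<k → f j 1≤j (s≤s⁻¹ j<k)) (λ f j 1≤j j≤k → f j 1≤j (s≤s j≤k))
      (all-upTo? (λ j → any? λ w → (w ∈? ⊤) ×-dec adj? u w ×-dec (c w ℕ.≟ j) ×-dec
        isBVertex? ⊤ (suc k) c w) k)

  proper? : ∀ k c → Dec (Proper k c)
  proper? k c =
    all? (λ v → (v ∈? ⊤) →-dec ((1 ℕ.≤? c v) ×-dec (c v ℕ.≤? k))) ×-dec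
    all? (λ u → all? λ v → (u ∈? ⊤) →-dec (v ∈? ⊤) →-dec adj? u v →-dec ¬? (c u ℕ.≟ c v))

  IsBStarColoring : ℕ → (Fin n → ℕ) → Set
  IsBStarColoring k c = Proper k c × Σ (Fin n) (IsCenter ⊤ k c)

  isBVertex-resp : ∀ {k c d u} → c ≗ d → IsB k c u → IsB k d u
  isBVertex-resp {u = u} c≗d b j 1≤j j≤k j≢du =
    let (w , w∈ , u~w , cw≡j) = b j 1≤j j≤k λ j≡cu → j≢du (trans j≡cu (c≗d u))
    in w , w∈ , u~w , trans (sym (c≗d w)) cw≡j

  isBStarColoring-resp : ∀ {k c d} → c ≗ d → IsBStarColoring k c → IsBStarColoring k d
  isBStarColoring-resp {k} {c} {d} c≗d ((range , proper) , u , u∈ , cu≡k , bu , nbrs) =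
    ((λ v v∈ → subst (λ x → 1 ≤ x × x ≤ k) (c≗d v) (range v v∈)) ,
     (λ v w v∈ w∈ v~w eq → proper v w v∈ w∈ v~w (trans (c≗d v) (trans eq (sym (c≗d w)))))) ,
    u , u∈ , trans (sym (c≗d u)) cu≡k , isBVertex-resp c≗d bu ,
    λ j 1≤j j<k → let (w , w∈ , u~w , cw≡j , bw) = nbrs j 1≤j j<k
                  in w , w∈ , u~w , trans (sym (c≗d w)) cw≡j , isBVertex-resp c≗d bw

  -- A proper coloring of all of `G` takes values from 1 to `k` only, so it is a map to `Fin k`
  -- shifted by one, and finitely many candidates remain.
  bStarColoring? : ∀ k → Dec (HasBStarColoringOn G ⊤ k)
  bStarColoring? k = map′
    (λ (f , good) → suc ∘ toℕ ∘ f , good)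
    (λ (c , good) → color c (proj₁ good) ,
      isBStarColoring-resp (λ v → sym (color≡ c (proj₁ good) v)) good)
    (any-function? {k = k} {P = λ f → IsBStarColoring k (suc ∘ toℕ ∘ f)}
      (λ f → proper? k _ ×-dec any? (isCenter? k _))
      (λ f≗g → isBStarColoring-resp (λ v → cong (suc ∘ toℕ) (f≗g v))))
    where
    color : ∀ c → Proper k c → Fin n → Fin k
    color c (range , _) v = proj₁ (color-index (c v) (proj₁ (range v ∈⊤)) (proj₂ (range v ∈⊤)))
    color≡ : ∀ c (p : Proper k c) v → suc (toℕ (color c p v)) ≡ c v
    color≡ c (range , _) v = proj₂ (color-index (c v) (proj₁ (range v ∈⊤)) (proj₂ (range v ∈⊤)))

  -- Existence of a b*-coloring by recoloring.

  missing-color : ∀ {k c} v → ¬ IsB k c v →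
    Σ ℕ λ d → 1 ≤ d × d ≤ k × d ≢ c v × (∀ w → Adj v w → c w ≢ d)
  missing-color {k} {c} v ¬b
    with all-or-missing (λ j → ¬? (j ℕ.≟ c v) →-dec
           any? (λ w → (w ∈? ⊤) ×-dec adj? v w ×-dec (c w ℕ.≟ j))) k
  ... | inj₁ b = contradiction b ¬b
  ... | inj₂ (d , 1≤d , d≤k , missing) = d , 1≤d , d≤k ,
    -- If `d` were the color of `v`, the implication refuted by `missing` would hold vacuously.
    (λ d≡cv → missing λ d≢cv → contradiction d≡cv d≢cv) ,
    (λ w v~w cw≡d → missing λ _ → w , ∈⊤ , v~w , cw≡d)

  -- Only b-vertex neighbours of the colors 1 to `k` are tested: since `u` has color `suc k`, having
  -- them all already makes `u` a b-vertex.
  center-or-replaceable : ∀ {k c} u → c u ≡ suc k → IsCenter ⊤ (suc k) c u ⊎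
    Σ ℕ λ j → 1 ≤ j × j ≤ k × (∀ w → Adj u w → c w ≡ j → ¬ IsB (suc k) c w)
  center-or-replaceable {k} {c} u cu≡k
    with all-or-missing (λ j → any? λ w → (w ∈? ⊤) ×-dec adj? u w ×-dec (c w ℕ.≟ j) ×-dec
           isBVertex? ⊤ (suc k) c w) k
  ... | inj₂ (j , 1≤j , j≤k , ¬nbr) =
    inj₂ (j , 1≤j , j≤k , λ w u~w cw≡j bw → ¬nbr (w , ∈⊤ , u~w , cw≡j , bw))
  ... | inj₁ nbrs = inj₁ (∈⊤ , cu≡k , bu , λ j 1≤j j<k → nbrs j 1≤j (s≤s⁻¹ j<k))
    where
    bu : IsB (suc k) c u
    bu j 1≤j j≤1+k j≢cu =
      let (w , w∈ , u~w , cw≡j , _) =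
            nbrs j 1≤j (s≤s⁻¹ (ℕ.≤∧≢⇒< j≤1+k λ j≡k → j≢cu (trans j≡k (sym cu≡k))))
      in w , w∈ , u~w , cw≡j

  -- The neighbours of u of color j move to colors missing around them, which are
  -- different from c u since they see u; this frees j for u.
  module Recolor {k c} (proper : Proper (suc k) c) {u} (cu≡k : c u ≡ suc k)
    {j} (1≤j : 1 ≤ j) (j≤k : j ≤ k) (¬b : ∀ w → Adj u w → c w ≡ j → ¬ IsB (suc k) c w) where

    -- Each case stores the reason for the new color, so that later arguments analyse this evidence
    -- and never unfold `new-color`.
    data New (v : Fin n) (d : ℕ) : Set where
      target : v ≡ u → d ≡ j → New v d
      moved  : Adj u v → c v ≡ j → 1 ≤ d → d ≤ suc k → d ≢ c v → (∀ w → Adj v w → c w ≢ d) → New v d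
      kept   : v ≢ u → ¬ (Adj u v × c v ≡ j) → d ≡ c v → New v d

    new-color : ∀ v → Σ ℕ (New v)
    new-color v with v ≟ u
    ... | yes v≡u = j , target v≡u refl
    ... | no v≢u with adj? u v ×-dec (c v ℕ.≟ j)
    ...   | no stays = c v , kept v≢u stays refl
    ...   | yes (u~v , cv≡j) with missing-color v (¬b v u~v cv≡j)
    ...     | d , 1≤d , d≤k , d≢cv , missing = d , moved u~v cv≡j 1≤d d≤k d≢cv missing

    recolored : Fin n → ℕ
    recolored = proj₁ ∘ new-color

    new-range : ∀ {v d} → New v d → 1 ≤ d × d ≤ suc k
    new-range (target _ refl) = 1≤j , ℕ.m≤n⇒m≤1+n j≤k
    new-range (moved _ _ 1≤d d≤k _ _) = 1≤d , d≤k
    new-range {v} (kept _ _ refl) = proj₁ proper v ∈⊤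

    -- Two moved vertices both had color `j`, so they are not adjacent. A moved vertex avoids `j`
    -- and all old colors around it, which settles `u` and kept neighbours. A kept neighbour of `u`
    -- does not have color `j`, since all such neighbours moved.
    new-proper : ∀ {v w d e} → Adj v w → New v d → New w e → d ≢ e
    new-proper v~w (target refl _) (target refl _) _ = irrefl v~w
    new-proper v~w (target refl refl) (moved _ cw≡j _ _ d≢cw _) j≡d =
      d≢cw (trans (sym j≡d) (sym cw≡j))
    new-proper v~w (target refl refl) (kept _ stays refl) j≡cw = stays (v~w , sym j≡cw)
    new-proper {v} {w} v~w (moved _ cv≡j _ _ _ _) (moved _ cw≡j _ _ _ _) _ =
      proj₂ proper v w ∈⊤ ∈⊤ v~w (trans cv≡j (sym cw≡j))
    new-proper {w = w} v~w (moved _ _ _ _ _ missing) (kept _ _ refl) d≡cw =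
      missing w v~w (sym d≡cw)
    new-proper {v} {w} v~w (kept _ _ refl) (kept _ _ refl) = proj₂ proper v w ∈⊤ ∈⊤ v~w
    new-proper v~w (moved _ cv≡j _ _ d≢cv _) (target refl refl) d≡j =
      d≢cv (trans d≡j (sym cv≡j))
    new-proper v~w (kept _ stays refl) (target refl refl) cv≡j = stays (symm v~w , cv≡j)
    new-proper {v} v~w (kept _ _ refl) (moved _ _ _ _ _ missing) = missing v (symm v~w)

    recolored-proper : Proper (suc k) recolored
    recolored-proper =
      (λ v _ → new-range (proj₂ (new-color v))) ,
      (λ v w _ _ v~w → new-proper v~w (proj₂ (new-color v)) (proj₂ (new-color w)))

    -- A moved vertex sees `u`, whose old color is `suc k`, so its missing color is another one.
    -- Hence no vertex newly acquires the last color, and a sweep through the vertices never undoes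
    -- its progress.
    new-last⇒old-last : ∀ {v d} → New v d → d ≡ suc k → c v ≡ suc k
    new-last⇒old-last (target refl _) _ = cu≡k
    new-last⇒old-last (moved u~v _ _ _ _ missing) refl = contradiction cu≡k (missing u (symm u~v))
    new-last⇒old-last (kept _ _ refl) cv≡k = cv≡k

    target-not-last : ∀ {d} → New u d → d ≢ suc k
    target-not-last (target _ refl) = ℕ.<⇒≢ (s≤s j≤k)
    target-not-last (moved u~u _ _ _ _ _) = ⊥-elim (irrefl u~u)
    target-not-last (kept u≢u _ _) = contradiction refl u≢u

  clear-last-color : ∀ {k c} → Proper (suc k) c → (vs : List (Fin n)) →
    HasBStarColoringOn G ⊤ (suc k) ⊎
    Σ (Fin n → ℕ) λ d → Proper (suc k) d × All (λ v → d v ≢ suc k) vs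
  clear-last-color proper [] = inj₂ (_ , proper , [])
  clear-last-color {k} proper (v ∷ vs) with clear-last-color proper vs
  ... | inj₁ found = inj₁ found
  ... | inj₂ (d , d-proper , cleared) with d v ℕ.≟ suc k
  ...   | no dv≢k = inj₂ (d , d-proper , dv≢k ∷ cleared)
  ...   | yes dv≡k with center-or-replaceable v dv≡k
  ...     | inj₁ center = inj₁ (d , d-proper , v , center)
  ...     | inj₂ (j , 1≤j , j≤k , ¬b) = inj₂ (recolored , recolored-proper ,
            target-not-last (proj₂ (new-color v)) ∷
            All.map (λ {w} dw≢k eq → dw≢k (new-last⇒old-last (proj₂ (new-color w)) eq)) cleared)
    where open Recolor d-proper dv≡k 1≤j j≤k ¬b

  proper⇒bStarColoring : Fin n → ∀ k c → Proper k c → ∃ (HasBStarColoringOn G ⊤)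
  proper⇒bStarColoring x zero c (range , _) =
    -- With no colors left, `x` could not be colored, so the descent must have found a b*-coloring
    -- earlier.
    contradiction (ℕ.≤-trans (proj₁ (range x ∈⊤)) (proj₂ (range x ∈⊤))) λ ()
  proper⇒bStarColoring x (suc k) c proper with clear-last-color proper (allFin n)
  ... | inj₁ found = suc k , found
  ... | inj₂ (d , (range , d-proper) , cleared) = proper⇒bStarColoring x k d
    ((λ v _ → proj₁ (range v ∈⊤) ,
       s≤s⁻¹ (ℕ.≤∧≢⇒< (proj₂ (range v ∈⊤)) (All.lookup cleared (∈-allFin v)))) ,
     d-proper)

  bStarColoring-exists : Fin n → ∃ (HasBStarColoringOn G ⊤)
  bStarColoring-exists x = proper⇒bStarColoring x n (suc ∘ toℕ)
    ((λ v _ → s≤s z≤n , toℕ<n v) ,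
     (λ { v w _ _ v~w eq → irrefl (subst (Adj v) (sym (toℕ-injective (ℕ.suc-injective eq))) v~w) }))

  bStar-exists : ∀ {m} → Fin n → (∀ j → HasMStarWitness G j → j ≤ m) → Σ ℕ (IsBStar G)
  bStar-exists {m} x ub =
    bounded-maximum bStarColoring? (bStarColoring-exists x) (suc m) (bStarColoring-≤ ⊤ ub)

  -- Five-cycles sharing a path of length two.

  module _ (girth : GirthGreaterThanFour G) where

    no-triangle : NoTriangle G
    no-triangle = proj₁ girth

    no-square : NoFourCycle G
    no-square = proj₂ girth

    record ClosedWalk₅ (x y z a b : Fin n) : Set where
      constructor walk
      field
        xy : Adj x y
        yz : Adj y z
        za : Adj z a
        ab : Adj a b
        bx : Adj b x

    private
      vertices : (x y z a b : Fin n) → Fin 5 → Fin n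
      vertices x y z a b 0F = x
      vertices x y z a b 1F = y
      vertices x y z a b 2F = z
      vertices x y z a b 3F = a
      vertices x y z a b 4F = b

      adjacent-≢ : ∀ {p q} → Adj p q → p ≢ q
      adjacent-≢ p~q refl = irrefl p~q

      path₃-≢ : ∀ {p q r s} → Adj p q → Adj q r → Adj r s → p ≢ s
      path₃-≢ p~q q~r r~s refl = no-triangle _ _ _ p~q q~r r~s

    -- Without triangles, a closed walk of length five cannot repeat a vertex.
    cycle : ∀ {x y z a b} → ClosedWalk₅ x y z a b → Cycle5 G
    cycle {x} {y} {z} {a} {b} (walk xy yz za ab bx) = record
      { vtx = vertices x y z a b
      ; inj = λ {i} {j} → inj i j
      ; edges = λ { 0F → xy ; 1F → yz ; 2F → za ; 3F → ab ; 4F → bx }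
      }
      where
      inj : ∀ i j → vertices x y z a b i ≡ vertices x y z a b j → i ≡ j
      inj 0F 0F _ = refl
      inj 1F 1F _ = refl
      inj 2F 2F _ = refl
      inj 3F 3F _ = refl
      inj 4F 4F _ = refl
      inj 0F 1F eq = contradiction eq (adjacent-≢ xy)
      inj 1F 0F eq = contradiction (sym eq) (adjacent-≢ xy)
      inj 1F 2F eq = contradiction eq (adjacent-≢ yz)
      inj 2F 1F eq = contradiction (sym eq) (adjacent-≢ yz)
      inj 2F 3F eq = contradiction eq (adjacent-≢ za)
      inj 3F 2F eq = contradiction (sym eq) (adjacent-≢ za)
      inj 3F 4F eq = contradiction eq (adjacent-≢ ab)
      inj 4F 3F eq = contradiction (sym eq) (adjacent-≢ ab)
      inj 4F 0F eq = contradiction eq (adjacent-≢ bx)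
      inj 0F 4F eq = contradiction (sym eq) (adjacent-≢ bx)
      inj 2F 0F eq = contradiction eq (path₃-≢ za ab bx)
      inj 0F 2F eq = contradiction (sym eq) (path₃-≢ za ab bx)
      inj 3F 1F eq = contradiction eq (path₃-≢ ab bx xy)
      inj 1F 3F eq = contradiction (sym eq) (path₃-≢ ab bx xy)
      inj 4F 2F eq = contradiction eq (path₃-≢ bx xy yz)
      inj 2F 4F eq = contradiction (sym eq) (path₃-≢ bx xy yz)
      inj 0F 3F eq = contradiction eq (path₃-≢ xy yz za)
      inj 3F 0F eq = contradiction (sym eq) (path₃-≢ xy yz za)
      inj 1F 4F eq = contradiction eq (path₃-≢ yz za ab)
      inj 4F 1F eq = contradiction (sym eq) (path₃-≢ yz za ab)

    edge⇒onCycle : ∀ C {p q} → EdgeOf G C p q → OnCycle G C p × OnCycle G C q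
    edge⇒onCycle C (i , inj₁ (p≡ , q≡)) = (i , p≡) , (next5 G i , q≡)
    edge⇒onCycle C (i , inj₂ (q≡ , p≡)) = (next5 G i , p≡) , (i , q≡)

    -- Either of `a ≡ b′` and `b ≡ a′` would close a 4-cycle on `x`, `y`, `z`, and `b ≡ b′` would
    -- close one on `z`, `a`, `b`, `a′`. So as soon as `a` and `a′` differ, the cycles meet exactly
    -- in the path `x y z`.
    module SharedPath {x y z a b a′ b′ : Fin n} (w : ClosedWalk₅ x y z a b)
      (w′ : ClosedWalk₅ x y z a′ b′) (a≢a′ : a ≢ a′) where

      private
        open ClosedWalk₅ w
        open ClosedWalk₅ w′ using () renaming (za to za′; ab to ab′; bx to bx′)

        C D : Cycle5 G
        C = cycle w
        D = cycle w′

        distinct : ∀ {i j} → i ≢ j → Cycle5.vtx C i ≢ Cycle5.vtx C j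
        distinct i≢j eq = i≢j (Cycle5.inj C eq)

        x≢z : x ≢ z
        x≢z = distinct {0F} {2F} λ ()

      a∉D : ¬ OnCycle G D a
      a∉D (0F , eq) = distinct {0F} {3F} (λ ()) eq
      a∉D (1F , eq) = distinct {1F} {3F} (λ ()) eq
      a∉D (2F , eq) = distinct {2F} {3F} (λ ()) eq
      a∉D (3F , eq) = a≢a′ (sym eq)
      a∉D (4F , refl) = no-square x y z a x≢z (distinct {1F} {3F} λ ()) xy yz za bx′

      b∉D : ¬ OnCycle G D b
      b∉D (0F , eq) = distinct {0F} {4F} (λ ()) eq
      b∉D (1F , eq) = distinct {1F} {4F} (λ ()) eq
      b∉D (2F , eq) = distinct {2F} {4F} (λ ()) eq
      b∉D (3F , refl) = no-square x y z b x≢z (distinct {1F} {4F} λ ()) xy yz za′ bx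
      b∉D (4F , refl) = no-square z a b a′ (distinct {2F} {4F} λ ()) a≢a′
        za ab (symm ab′) (symm za′)

      distinct-cycles : ¬ SameCycle G C D
      distinct-cycles same =
        a∉D (proj₂ (edge⇒onCycle D (Equivalence.to (same z a) (2F , inj₁ (refl , refl)))))

      intersect : IntersectInP2 G C D
      intersect = x , y , z , adjacent-≢ xy , adjacent-≢ yz , x≢z ,
        (λ v → mk⇔ common-vertex λ where
          (inj₁ refl) → (0F , refl) , (0F , refl)
          (inj₂ (inj₁ refl)) → (1F , refl) , (1F , refl)
          (inj₂ (inj₂ refl)) → (2F , refl) , (2F , refl)) ,
        (λ p q → mk⇔ common-edge λ where
          (inj₁ (refl , refl)) → (0F , inj₁ (refl , refl)) , (0F , inj₁ (refl , refl))
          (inj₂ (inj₁ (refl , refl))) → (0F , inj₂ (refl , refl)) , (0F , inj₂ (refl , refl))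
          (inj₂ (inj₂ (inj₁ (refl , refl)))) →
            (1F , inj₁ (refl , refl)) , (1F , inj₁ (refl , refl))
          (inj₂ (inj₂ (inj₂ (refl , refl)))) →
            (1F , inj₂ (refl , refl)) , (1F , inj₂ (refl , refl)))
        where
        common-vertex : ∀ {v} → OnCycle G C v × OnCycle G D v → v ≡ x ⊎ v ≡ y ⊎ v ≡ z
        common-vertex ((0F , refl) , _) = inj₁ refl
        common-vertex ((1F , refl) , _) = inj₂ (inj₁ refl)
        common-vertex ((2F , refl) , _) = inj₂ (inj₂ refl)
        common-vertex ((3F , refl) , onD) = contradiction onD a∉D
        common-vertex ((4F , refl) , onD) = contradiction onD b∉D
        common-edge : ∀ {p q} → EdgeOf G C p q × EdgeOf G D p q →
          (p ≡ x × q ≡ y) ⊎ (p ≡ y × q ≡ x) ⊎ (p ≡ y × q ≡ z) ⊎ (p ≡ z × q ≡ y)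
        common-edge ((0F , inj₁ (refl , refl)) , _) = inj₁ (refl , refl)
        common-edge ((0F , inj₂ (refl , refl)) , _) = inj₂ (inj₁ (refl , refl))
        common-edge ((1F , inj₁ (refl , refl)) , _) = inj₂ (inj₂ (inj₁ (refl , refl)))
        common-edge ((1F , inj₂ (refl , refl)) , _) = inj₂ (inj₂ (inj₂ (refl , refl)))
        common-edge ((2F , inj₁ (refl , refl)) , e) = contradiction (proj₂ (edge⇒onCycle D e)) a∉D
        common-edge ((2F , inj₂ (refl , refl)) , e) = contradiction (proj₁ (edge⇒onCycle D e)) a∉D
        common-edge ((3F , inj₁ (refl , refl)) , e) = contradiction (proj₁ (edge⇒onCycle D e)) a∉D
        common-edge ((3F , inj₂ (refl , refl)) , e) = contradiction (proj₂ (edge⇒onCycle D e)) a∉D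
        common-edge ((4F , inj₁ (refl , refl)) , e) = contradiction (proj₁ (edge⇒onCycle D e)) b∉D
        common-edge ((4F , inj₂ (refl , refl)) , e) = contradiction (proj₂ (edge⇒onCycle D e)) b∉D

    module _ (no-P₂ : NoTwoFiveCyclesMeetInP2 G) where

      -- The form in which the hypothesis on 5-cycles is used: the path `x y z` determines the next
      -- vertex of a 5-cycle through it.
      shared-path⇒≡ : ∀ {x y z a b a′ b′} → ClosedWalk₅ x y z a b → ClosedWalk₅ x y z a′ b′ →
        a ≡ a′
      shared-path⇒≡ {a = a} {a′ = a′} w w′ = decidable-stable (a ≟ a′) λ a≢a′ →
        let open SharedPath w w′ a≢a′ in no-P₂ (cycle w) (cycle w′) distinct-cycles intersect

      -- The colored subgraph around a vertex with many neighbours of large degree.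

      module Star {m} (witness : HasMStarWitness G m) where

        u : Fin n
        u = proj₁ witness

        us : Fin m → Fin n
        us = proj₁ (proj₂ witness)

        us-inj : Injective _≡_ _≡_ us
        us-inj = proj₁ (proj₂ (proj₂ witness))

        u~us : ∀ i → Adj u (us i)
        u~us i = proj₁ (proj₂ (proj₂ (proj₂ witness)) i)

        Link : Fin m → Fin m → Fin n → Set
        Link i j x = x ≢ u × Adj (us i) x × ∃ λ w → w ≢ u × Adj (us j) w × Adj x w

        link? : ∀ i j x → Dec (Link i j x)
        link? i j x = ¬? (x ≟ u) ×-dec adj? (us i) x ×-dec
          any? λ w → ¬? (w ≟ u) ×-dec adj? (us j) w ×-dec adj? x w

        -- The forced values of `g i`: `u` at `i` itself, and at `j` the end in N(`us i`) of an edge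
        -- to N(`us j`), both sets without `u`. Color `j` on that end keeps it away from every leaf
        -- of color `j`, as `us j` has no leaf of its own color.
        preference : ∀ i → PartialInjection m (Adj (us i))
        preference i .Rel j x = (i ≡ j × x ≡ u) ⊎ (i ≢ j × Link i j x)
        preference i .rel? j x = ((i ≟ j) ×-dec (x ≟ u)) ⊎-dec (¬? (i ≟ j) ×-dec link? i j x)
        preference i .functional (inj₁ (_ , refl)) (inj₁ (_ , refl)) = refl
        preference i .functional (inj₁ (i≡j , _)) (inj₂ (i≢j , _)) = contradiction i≡j i≢j
        preference i .functional (inj₂ (i≢j , _)) (inj₁ (i≡j , _)) = contradiction i≡j i≢j
        preference i .functional {j}
          (inj₂ (_ , _ , i~x , w , _ , j~w , x~w)) (inj₂ (_ , _ , i~y , w′ , _ , j~w′ , y~w′)) =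
          -- Two linking edges give 5-cycles through the path `us j`, `u`, `us i`.
          shared-path⇒≡ {us j} {u} {us i}
            (walk (symm (u~us j)) (u~us i) i~x x~w (symm j~w))
            (walk (symm (u~us j)) (u~us i) i~y y~w′ (symm j~w′))
        preference i .injective (inj₁ (refl , _)) (inj₁ (refl , _)) = refl
        preference i .injective (inj₁ (_ , x≡u)) (inj₂ (_ , x≢u , _)) = contradiction x≡u x≢u
        preference i .injective (inj₂ (_ , x≢u , _)) (inj₁ (_ , x≡u)) = contradiction x≡u x≢u
        preference i .injective {j} {j′} {x}
          (inj₂ (_ , _ , i~x , w , w≢u , j~w , x~w)) (inj₂ (_ , _ , _ , w′ , _ , j′~w′ , x~w′))
          -- Links from `x` towards `us j` and `us j′` give 5-cycles through `u`, `us i`, `x`, so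
          -- `w` and `w′` agree; then `us j` and `us j′` share the neighbours `u` and `w`, which
          -- forbids a 4-cycle only if they coincide.
          with shared-path⇒≡ {u} {us i} {x}
                 (walk (u~us i) i~x x~w (symm j~w) (symm (u~us j)))
                 (walk (u~us i) i~x x~w′ (symm j′~w′) (symm (u~us j′)))
        ... | refl = us-inj (decidable-stable (us j ≟ us j′) λ j≢j′ →
          no-square u (us j) w (us j′) (≢-sym w≢u) j≢j′ (u~us j) j~w (symm j′~w′) (symm (u~us j′)))
        preference i .sound (inj₁ (_ , refl)) = symm (u~us i)
        preference i .sound (inj₂ (_ , _ , i~x , _)) = i~x

        chosen : ∀ i → Σ (Fin m → Fin n) λ g → Injective _≡_ _≡_ g ×
          (∀ j → Adj (us i) (g j)) × (∀ {j x} → Rel (preference i) j x → g j ≡ x)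
        chosen i =
          let (e , e-inj , i~e) = ≤deg⇒injection (proj₂ (proj₂ (proj₂ (proj₂ witness)) i))
          in extend-injection e e-inj i~e (preference i)

        g : Fin m → Fin m → Fin n
        g i = proj₁ (chosen i)

        g-inj : ∀ i → Injective _≡_ _≡_ (g i)
        g-inj i = proj₁ (proj₂ (chosen i))

        us~g : ∀ i j → Adj (us i) (g i j)
        us~g i = proj₁ (proj₂ (proj₂ (chosen i)))

        g-extends : ∀ i {j x} → Rel (preference i) j x → g i j ≡ x
        g-extends i = proj₂ (proj₂ (proj₂ (chosen i)))

        g≢u : ∀ {i j} → i ≢ j → g i j ≢ u
        g≢u {i} i≢j g≡u = i≢j (g-inj i (trans (g-extends i (inj₁ (refl , refl))) (sym g≡u)))

        -- The edge makes `g i j` the preferred end towards `i′`, so `g i i′` is the same vertex,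
        -- and injectivity of `g i` identifies the indices.
        g-linked : ∀ {i j i′ j′} → i ≢ j → i′ ≢ j′ → i ≢ i′ → Adj (g i j) (g i′ j′) → i′ ≡ j
        g-linked {i} {j} {i′} {j′} i≢j i′≢j′ i≢i′ adj = g-inj i (g-extends i
          (inj₂ (i≢i′ , g≢u i≢j , us~g i j , g i′ j′ , g≢u i′≢j′ , us~g i′ j′ , adj)))

        common-neighbour : ∀ {i k x} → x ≢ u → Adj (us i) x → Adj (us k) x → i ≡ k
        common-neighbour {i} {k} {x} x≢u i~x k~x =
          us-inj (decidable-stable (us i ≟ us k) λ i≢k →
            no-square u (us i) x (us k) (≢-sym x≢u) i≢k (u~us i) i~x (symm k~x) (symm (u~us k)))

        us≁us : ∀ i k → ¬ Adj (us i) (us k)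
        us≁us i k i~k = no-triangle u (us i) (us k) (u~us i) i~k (symm (u~us k))

        color : Fin m → ℕ
        color i = suc (toℕ i)

        color-inj : Injective _≡_ _≡_ color
        color-inj eq = toℕ-injective (ℕ.suc-injective eq)

        color<last : ∀ i → color i < suc m
        color<last i = s≤s (toℕ<n i)

        -- A relation, since a vertex may have several descriptions; `colored-functional` shows that
        -- they agree on the color. Leaves exclude the diagonal because `g i i` is `u`.
        data Colored (v : Fin n) (c : ℕ) : Set where
          center : v ≡ u → c ≡ suc m → Colored v c
          middle : ∀ i → v ≡ us i → c ≡ color i → Colored v c
          leaf   : ∀ {i j} → i ≢ j → v ≡ g i j → c ≡ color j → Colored v c

        colored? : ∀ v → Dec (∃ (Colored v))
        colored? v = map′
          (λ where
            (inj₁ eq) → _ , center eq refl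
            (inj₂ (inj₁ (i , eq))) → _ , middle i eq refl
            (inj₂ (inj₂ (i , j , i≢j , eq))) → _ , leaf i≢j eq refl)
          (λ where
            (_ , center eq _) → inj₁ eq
            (_ , middle i eq _) → inj₂ (inj₁ (i , eq))
            (_ , leaf {i} {j} i≢j eq _) → inj₂ (inj₂ (i , j , i≢j , eq)))
          ((v ≟ u) ⊎-dec any? (λ i → v ≟ us i) ⊎-dec
            any? λ i → any? λ j → ¬? (i ≟ j) ×-dec (v ≟ g i j))

        -- The three kinds are disjoint: a leaf is not `u` by injectivity of `g i`, nor some `us k`,
        -- as that would give a triangle. Leaves of different `us i` differ, since they would close
        -- a 4-cycle with `u`.
        colored-functional : ∀ {v c d} → Colored v c → Colored v d → c ≡ d
        colored-functional (center _ refl) (center _ refl) = refl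
        colored-functional (center refl _) (middle i u≡us _) =
          contradiction (subst (Adj u) (sym u≡us) (u~us i)) irrefl
        colored-functional (center refl _) (leaf i≢j u≡g _) = contradiction (sym u≡g) (g≢u i≢j)
        colored-functional (middle i us≡u _) (center refl _) =
          contradiction (subst (Adj u) (sym us≡u) (u~us i)) irrefl
        colored-functional (middle i refl refl) (middle k eq refl) = cong color (us-inj eq)
        colored-functional (middle k refl _) (leaf {i} {j} _ eq _) =
          contradiction (subst (Adj (us i)) (sym eq) (us~g i j)) (us≁us i k)
        colored-functional (leaf i≢j g≡u _) (center refl _) = contradiction (sym g≡u) (g≢u i≢j)
        colored-functional (leaf {i} {j} _ eq _) (middle k refl _) =
          contradiction (subst (Adj (us i)) (sym eq) (us~g i j)) (us≁us i k)
        colored-functional (leaf {i} {j} i≢j refl refl) (leaf {i′} {j′} i′≢j′ eq refl)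
          with common-neighbour (g≢u i≢j) (us~g i j) (subst (Adj (us i′)) (sym eq) (us~g i′ j′))
        ... | refl = cong color (g-inj i eq)

        middle-leaf : ∀ k {i j} → i ≢ j → Adj (us k) (g i j) → color k ≢ color j
        middle-leaf k {i} {j} i≢j k~g eq = i≢j
          (trans (common-neighbour (g≢u i≢j) (us~g i j) k~g) (color-inj eq))

        colored-proper : ∀ {v w c d} → Adj v w → Colored v c → Colored w d → c ≢ d
        colored-proper v~w (center refl _) (center refl _) _ = irrefl v~w
        colored-proper _ (center _ refl) (middle i _ refl) = ≢-sym (ℕ.<⇒≢ (color<last i))
        colored-proper _ (center _ refl) (leaf {j = j} _ _ refl) = ≢-sym (ℕ.<⇒≢ (color<last j))
        colored-proper _ (middle i _ refl) (center _ refl) = ℕ.<⇒≢ (color<last i)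
        colored-proper v~w (middle i refl _) (middle k refl _) _ = us≁us i k v~w
        colored-proper v~w (middle k refl refl) (leaf i≢j refl refl) = middle-leaf k i≢j v~w
        colored-proper _ (leaf {j = j} _ _ refl) (center _ refl) = ℕ.<⇒≢ (color<last j)
        colored-proper v~w (leaf i≢j refl refl) (middle k refl refl) =
          ≢-sym (middle-leaf k i≢j (symm v~w))
        -- Adjacent leaves of equal color: below the same `us i` they would be one vertex, and
        -- otherwise `g-linked` yields `i′ ≡ j`, so the second leaf would lie on the excluded
        -- diagonal.
        colored-proper v~w (leaf {i} {j} i≢j refl refl) (leaf {i′} {j′} i′≢j′ refl refl) eq
          with color-inj eq | i ≟ i′
        ... | refl | yes refl = irrefl v~w
        ... | refl | no i≢i′ = i′≢j′ (g-linked i≢j i′≢j′ i≢i′ v~w)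

        S : Subset n
        S = subset colored?

        coloring : Fin n → ℕ
        coloring v with colored? v
        ... | yes (c , _) = c
        -- A dummy value outside `S`, where no condition on the coloring looks.
        ... | no _ = 0

        coloring-colored : ∀ {v} → v ∈ S → Colored v (coloring v)
        coloring-colored {v} v∈S with colored? v | ∈-subset⁻ colored? v∈S
        ... | yes (_ , col) | _ = col
        ... | no ¬col | col = contradiction col ¬col

        colored⇒∈ : ∀ {v c} → Colored v c → v ∈ S
        colored⇒∈ col = ∈-subset⁺ colored? (_ , col)

        coloring≡ : ∀ {v c} → Colored v c → coloring v ≡ c
        coloring≡ col = colored-functional (coloring-colored (colored⇒∈ col)) col

        colored-range : ∀ {v c} → Colored v c → 1 ≤ c × c ≤ suc m
        colored-range (center _ refl) = s≤s z≤n , ℕ.≤-refl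
        colored-range (middle i _ refl) = s≤s z≤n , ℕ.<⇒≤ (color<last i)
        colored-range (leaf {j = j} _ _ refl) = s≤s z≤n , ℕ.<⇒≤ (color<last j)

        center-col : Colored u (suc m)
        center-col = center refl refl

        middle-col : ∀ i → Colored (us i) (color i)
        middle-col i = middle i refl refl

        middle-neighbour : ∀ j → 1 ≤ j → j < suc m →
          ∃ λ i → us i ∈ S × Adj u (us i) × coloring (us i) ≡ j
        middle-neighbour j 1≤j j<1+m with color-index j 1≤j (s≤s⁻¹ j<1+m)
        ... | i , refl = i , colored⇒∈ (middle-col i) , u~us i , coloring≡ (middle-col i)

        center-bVertex : IsBVertexOn G S (suc m) coloring u
        center-bVertex j 1≤j j≤1+m j≢ =
          let (i , rest) = middle-neighbour j 1≤j (ℕ.≤∧≢⇒< j≤1+m λ j≡ →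
                j≢ (trans j≡ (sym (coloring≡ center-col))))
          in us i , rest

        middle-bVertex : ∀ i → IsBVertexOn G S (suc m) coloring (us i)
        middle-bVertex i j 1≤j j≤1+m j≢ with ℕ.m≤n⇒m<n∨m≡n j≤1+m
        ... | inj₂ refl = u , colored⇒∈ center-col , symm (u~us i) , coloring≡ center-col
        ... | inj₁ j<1+m with color-index j 1≤j (s≤s⁻¹ j<1+m)
        ...   | k , refl = g i k , colored⇒∈ leaf-col , us~g i k , coloring≡ leaf-col
          where
          leaf-col : Colored (g i k) (color k)
          -- The index `k` differs from `i`, as `j` is not the color of `us i`.
          leaf-col = leaf (λ { refl → j≢ (sym (coloring≡ (middle-col i))) }) refl refl

        bStarColoring : HasBStarColoringOn G S (suc m)
        bStarColoring = coloring ,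
          ((λ v v∈S → colored-range (coloring-colored v∈S)) ,
           (λ v w v∈S w∈S v~w → colored-proper v~w (coloring-colored v∈S) (coloring-colored w∈S))) ,
          u , colored⇒∈ center-col , coloring≡ center-col , center-bVertex ,
          λ j 1≤j j<1+m →
            let (i , us∈S , u~us , eq) = middle-neighbour j 1≤j j<1+m
            in us i , us∈S , u~us , eq , middle-bVertex i

-- Transfer to the whole graph by monotonicity.

theorem3 : (G : Graph) → Fin (Graph.n G) →
    BStarMonotonic G → GirthGreaterThanFour G → NoTwoFiveCyclesMeetInP2 G →
    Σ ℕ λ m → IsMStar G m × IsBStar G (suc m)
theorem3 G x monotonic girth no-P₂ with mStar-exists G x
... | m , witness , m-max with bStar-exists G x m-max
...   | k , bStar = m , (witness , m-max) , subst (IsBStar G) k≡1+m bStar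
  where
  open Star G girth no-P₂ witness using (S; bStarColoring)
  k≡1+m : k ≡ suc m
  k≡1+m = ℕ.≤-antisym (bStarColoring-≤ G ⊤ m-max k (proj₁ bStar))
    -- The upper bound also holds on `S`, so b* of that subgraph is exactly `suc m`, as monotonicity
    -- requires an attained maximum on both sides.
    (monotonic ⊤ S (λ _ → ∈⊤) k (suc m) bStar (bStarColoring , bStarColoring-≤ G S m-max))
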